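{- Let $M$ be a connected $2$-polymatroid and let $N$ be a connected proper minor of $M$. Then there is a unique constrained admissible ordering of $E(M)-E(N)$ if and only if $|E(M)-E(N)|=1$.
   Context: For a positive integer $k$, a $k$-polymatroid $M$ is a pair $(E,r)$ consisting of a finite set $E=E(M)$ (the ground set) and a function $r=r_M$ (the rank function) from the power set of $E$ into the integers such that: (i) $r(\emptyset)=0$; (ii) $r(X)\le r(Y)$ whenever $X\subseteq Y\subseteq E$; (iii) $r(X)+r(Y)\ge r(X\cup Y)+r(X\cap Y)$ for all $X,Y\subseteq E$; (iv) $r(\{e\})\le k$ for all $e\in E$. A $2$-polymatroid is the case $k=2$; a polymatroid is a $k$-polymatroid for some $k$. For $T\subseteq E$, the deletion $M\backslash T$ and the contraction $M/T$ are the polymatroids on ground set $E-T$ with rank functions $r_{M\backslash T}(X)=r(X)$ and $r_{M/T}(X)=r(X\cup T)-r(T)$ for all $X\subseteq E-T$. A minor of $M$ is any polymatroid obtained from $M$ by a sequence of deletions and contractions (so its ground set is a subset of $E(M)$); it is proper if it is not equal to $M$. A polymatroid $(E,r)$ is connected if there is no non-empty proper subset $X$ of $E$ such that $r(X)+r(E-X)=r(E)$. Let $M$ be a connected polymatroid and $N$ a connected proper minor of $M$. A constrained admissible ordering of $E(M)-E(N)$ is an ordering $((\alpha_1,a_1),(\alpha_2,a_2),\ldots,(\alpha_n,a_n))$ such that $E(M)-E(N)=\{a_1,a_2,\ldots,a_n\}$ (where $a_1,\ldots,a_n$ are distinct), each $\alpha_i$ is a deletion or contraction operation, and, for each $k\in\{1,2,\ldots,n\}$,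 there is a connected minor $M_k$ of $M$ with ground set $E(M)-\{a_1,a_2,\ldots,a_k\}$ where $M_k$ is obtained from $M_{k-1}$ by removing $a_k$ by the operation designated by $\alpha_k$, and $(M_0,M_n)=(M,N)$.
   Formalization: The formal theorem additionally assumes |E(M)| ≥ 2: if E(M)={a} and N is the empty polymatroid, then M\a = M/a = N gives two constrained admissible orderings although |E(M)-E(N)|=1, so the statement fails there. -}

module Defs where

open import Data.Fin using (Fin)
open import Data.Fin.Subset
  using (Subset; _∈_; _⊆_; _∪_; _∩_; _─_; ⁅_⁆; Nonempty) renaming (⊥ to ∅)
open import Data.Fin.Subset.Properties
  using (⊥⊆; p─q⊆p; x∈⁅y⁆⇒x≡y; x∈p∪q⁻; x∈p∪q⁺; x∈p∩q⁻; ∪-assoc; ∪-comm; ∪-idem;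
         ∪-distribʳ-∩; ∪-identityˡ)
open import Data.Integer as ℤ using (ℤ; +_; 0ℤ; _≤_)
import Data.Integer.Properties as ℤ
open import Data.Integer.Tactic.RingSolver using (solve-∀)
open import Data.List using (List; []; _∷_; map)
import Data.List.Membership.Propositional as List
open import Data.List.Relation.Unary.Unique.Propositional using (Unique)
open import Data.Nat using (ℕ)
open import Data.Product using (∃-syntax; _×_; _,_; proj₁; proj₂)
open import Data.Sum using (inj₁; inj₂; [_,_])
open import Function using (_∘_; _⇔_)
open import Relation.Binary.PropositionalEquality
  using (_≡_; _≢_; refl; sym; trans; cong; cong₂; subst)
open import Relation.Nullary using (¬_)

private
  variable
    k n : ℕ

-- The ground set is an arbitrary subset E of an ambient universe Fin n, so that
-- the ground set of a minor is literally a subset of that of the original.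
-- `rank` is only meaningful on subsets of E: its values elsewhere are junk,
-- unconstrained by the axioms and ignored by `_≈_`.
record Polymatroid (k n : ℕ) : Set where
  field
    ground     : Subset n
    rank       : Subset n → ℤ
    rank-∅     : rank ∅ ≡ 0ℤ
    monotone   : ∀ X Y → X ⊆ Y → Y ⊆ ground → rank X ≤ rank Y
    submodular : ∀ X Y → X ⊆ ground → Y ⊆ ground →
                 rank (X ∪ Y) ℤ.+ rank (X ∩ Y) ≤ rank X ℤ.+ rank Y
    bounded    : ∀ e → e ∈ ground → rank ⁅ e ⁆ ≤ + k

open Polymatroid public

infix 4 _≈_

_≈_ : Polymatroid k n → Polymatroid k n → Set
M ≈ N = ground M ≡ ground N × (∀ X → X ⊆ ground M → rank M X ≡ rank N X)

Connected : Polymatroid k n → Set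
Connected M = ¬ (∃[ X ] X ⊆ ground M × Nonempty X × X ≢ ground M ×
                        rank M X ℤ.+ rank M (ground M ─ X) ≡ rank M (ground M))

delete : (M : Polymatroid k n) (T : Subset n) → T ⊆ ground M → Polymatroid k n
delete M T _ = record
  { ground     = ground M ─ T
  ; rank       = rank M
  ; rank-∅     = rank-∅ M
  ; monotone   = λ X Y X⊆Y Y⊆ → monotone M X Y X⊆Y (p─q⊆p _ T ∘ Y⊆)
  ; submodular = λ X Y X⊆ Y⊆ → submodular M X Y (p─q⊆p _ T ∘ X⊆) (p─q⊆p _ T ∘ Y⊆)
  ; bounded    = λ e e∈ → bounded M e (p─q⊆p _ T e∈)
  }

contract : (M : Polymatroid k n) (T : Subset n) → T ⊆ ground M → Polymatroid k n
contract {k} {n} M T T⊆E = record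
  { ground     = ground M ─ T
  ; rank       = λ X → r (X ∪ T) ℤ.- r T
  ; rank-∅     = trans (cong (λ Z → r Z ℤ.- r T) (∪-identityˡ T)) (ℤ.+-inverseʳ (r T))
  ; monotone   = λ X Y X⊆Y Y⊆ →
      ℤ.+-monoˡ-≤ (ℤ.- r T)
        (monotone M (X ∪ T) (Y ∪ T)
          (x∈p∪q⁺ ∘ [ inj₁ ∘ X⊆Y , inj₂ ] ∘ x∈p∪q⁻ X T) (∪T⊆E Y Y⊆))
  ; submodular = λ X Y X⊆ Y⊆ → sub X Y (∪T⊆E X X⊆) (∪T⊆E Y Y⊆)
  ; bounded    = bound
  }
  where
  r : Subset n → ℤ
  r = rank M

  ∪T⊆E : ∀ X → X ⊆ ground M ─ T → X ∪ T ⊆ ground M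
  ∪T⊆E X X⊆ = [ p─q⊆p _ T ∘ X⊆ , T⊆E ] ∘ x∈p∪q⁻ X T

  ∪-dist : ∀ X Y → (X ∪ T) ∪ (Y ∪ T) ≡ (X ∪ Y) ∪ T
  ∪-dist X Y =
    trans (∪-assoc X T (Y ∪ T))
      (trans (cong (X ∪_) (trans (cong (T ∪_) (∪-comm Y T))
                            (trans (sym (∪-assoc T T Y))
                              (trans (cong (_∪ Y) (∪-idem T)) (∪-comm T Y)))))
             (sym (∪-assoc X Y T)))

  shift : ∀ a b c → (a ℤ.+ b) ℤ.+ (ℤ.- c ℤ.+ ℤ.- c) ≡ (a ℤ.+ ℤ.- c) ℤ.+ (b ℤ.+ ℤ.- c)
  shift = solve-∀

  sub : ∀ X Y → X ∪ T ⊆ ground M → Y ∪ T ⊆ ground M →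
        (r ((X ∪ Y) ∪ T) ℤ.- r T) ℤ.+ (r ((X ∩ Y) ∪ T) ℤ.- r T)
        ≤ (r (X ∪ T) ℤ.- r T) ℤ.+ (r (Y ∪ T) ℤ.- r T)
  sub X Y X∪T⊆E Y∪T⊆E = begin
    (r ((X ∪ Y) ∪ T) ℤ.- r T) ℤ.+ (r ((X ∩ Y) ∪ T) ℤ.- r T)
      ≡⟨ shift (r ((X ∪ Y) ∪ T)) (r ((X ∩ Y) ∪ T)) (r T) ⟨
    (r ((X ∪ Y) ∪ T) ℤ.+ r ((X ∩ Y) ∪ T)) ℤ.+ (ℤ.- r T ℤ.+ ℤ.- r T)
      ≡⟨ cong (ℤ._+ (ℤ.- r T ℤ.+ ℤ.- r T))
           (cong₂ (λ A B → r A ℤ.+ r B) (∪-dist X Y) (sym (∪-distribʳ-∩ T X Y))) ⟨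
    (r ((X ∪ T) ∪ (Y ∪ T)) ℤ.+ r ((X ∪ T) ∩ (Y ∪ T))) ℤ.+ (ℤ.- r T ℤ.+ ℤ.- r T)
      ≤⟨ ℤ.+-monoˡ-≤ (ℤ.- r T ℤ.+ ℤ.- r T) (submodular M (X ∪ T) (Y ∪ T) X∪T⊆E Y∪T⊆E) ⟩
    (r (X ∪ T) ℤ.+ r (Y ∪ T)) ℤ.+ (ℤ.- r T ℤ.+ ℤ.- r T)
      ≡⟨ shift (r (X ∪ T)) (r (Y ∪ T)) (r T) ⟩
    (r (X ∪ T) ℤ.- r T) ℤ.+ (r (Y ∪ T) ℤ.- r T) ∎
    where open ℤ.≤-Reasoning

  cancel : ∀ a c → (a ℤ.+ c) ℤ.+ ℤ.- c ≡ a
  cancel = solve-∀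

  bound : ∀ e → e ∈ ground M ─ T → r (⁅ e ⁆ ∪ T) ℤ.- r T ≤ + k
  bound e e∈ = begin
    r (⁅ e ⁆ ∪ T) ℤ.- r T
      ≡⟨ cong (ℤ._- r T) (ℤ.+-identityʳ (r (⁅ e ⁆ ∪ T))) ⟨
    (r (⁅ e ⁆ ∪ T) ℤ.+ 0ℤ) ℤ.- r T
      ≤⟨ ℤ.+-monoˡ-≤ (ℤ.- r T) (ℤ.+-monoʳ-≤ (r (⁅ e ⁆ ∪ T)) 0≤) ⟩
    (r (⁅ e ⁆ ∪ T) ℤ.+ r (⁅ e ⁆ ∩ T)) ℤ.- r T
      ≤⟨ ℤ.+-monoˡ-≤ (ℤ.- r T) (submodular M ⁅ e ⁆ T e⊆E T⊆E) ⟩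
    (r ⁅ e ⁆ ℤ.+ r T) ℤ.- r T
      ≡⟨ cancel (r ⁅ e ⁆) (r T) ⟩
    r ⁅ e ⁆
      ≤⟨ bounded M e e∈E ⟩
    + k ∎
    where
    open ℤ.≤-Reasoning
    e∈E : e ∈ ground M
    e∈E = p─q⊆p _ T e∈
    e⊆E : ⁅ e ⁆ ⊆ ground M
    e⊆E x∈ = subst (_∈ ground M) (sym (x∈⁅y⁆⇒x≡y e x∈)) e∈E
    0≤ : 0ℤ ≤ r (⁅ e ⁆ ∩ T)
    0≤ = subst (_≤ r (⁅ e ⁆ ∩ T)) (rank-∅ M)
           (monotone M ∅ (⁅ e ⁆ ∩ T) ⊥⊆ (T⊆E ∘ proj₂ ∘ x∈p∩q⁻ ⁅ e ⁆ T))

data Operation : Set where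
  deletion contraction : Operation

remove : Operation → (M : Polymatroid k n) (T : Subset n) → T ⊆ ground M → Polymatroid k n
remove deletion    = delete
remove contraction = contract

removeElement : Operation → (M : Polymatroid k n) (a : Fin n) → a ∈ ground M → Polymatroid k n
removeElement α M a a∈E =
  remove α M ⁅ a ⁆ (λ x∈ → subst (_∈ ground M) (sym (x∈⁅y⁆⇒x≡y a x∈)) a∈E)

-- `N IsMinorOf M`: N results from M by a (possibly empty) sequence of operations.
infix 4 _IsMinorOf_

data _IsMinorOf_ {k n : ℕ} (N : Polymatroid k n) : Polymatroid k n → Set where
  done : ∀ {M} → M ≈ N → N IsMinorOf M
  step : ∀ {M} (α : Operation) (T : Subset n) (T⊆E : T ⊆ ground M) →
         N IsMinorOf remove α M T T⊆E → N IsMinorOf M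

_IsProperMinorOf_ : Polymatroid k n → Polymatroid k n → Set
N IsProperMinorOf M = N IsMinorOf M × ¬ (N ≈ M)

-- The sequence M = M₀, M₁, …, Mₙ = N is determined by M and the pairs (αᵢ , aᵢ):
-- each Mₖ is `removeElement αₖ Mₖ₋₁ aₖ`, hence automatically a minor of M with
-- ground set E(M) - {a₁,…,aₖ}.
data ConnectedChain {k n : ℕ} (N : Polymatroid k n) :
       Polymatroid k n → List (Operation × Fin n) → Set where
  []   : ∀ {M} → M ≈ N → ConnectedChain N M []
  cons : ∀ {M α a σ} (a∈E : a ∈ ground M) →
         Connected (removeElement α M a a∈E) →
         ConnectedChain N (removeElement α M a a∈E) σ →
         ConnectedChain N M ((α , a) ∷ σ)

record IsConstrainedAdmissibleOrdering {k n : ℕ} (M N : Polymatroid k n)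
         (σ : List (Operation × Fin n)) : Set where
  field
    distinct : Unique (map proj₂ σ)
    elements : ∀ e → e ∈ ground M ─ ground N ⇔ e List.∈ map proj₂ σ
    chain    : ConnectedChain N M σ

{-# OPTIONS --safe #-}
-- A separation of a polymatroid that does not survive the removal of d has {d} as one of
-- its sides, and then deleting d and contracting d have the same effect.
-- Suppose a chain starts with (α , a), (β , b) and is the only one.  Writing ᾱ for the other
-- operation, rerouting it through M β b, then through M ᾱ a, then through M β̄ b must fail
-- because each of these is disconnected; each failure yields a separator, which lets the
-- next rerouting end at the same minor.  So {a} separates both M \ b and M / b, and {b}
-- separates M \ a or M / a, whence {a , b} separates M unless E(M) = {a , b}, and in that
-- case the operation on b can be changed freely.
-- Conversely, a one-step chain is unique since M \ a = M / a would make {a} a separator of M.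
module Submission where

open import Defs
open import Data.Empty using (⊥; ⊥-elim)
open import Data.Fin using (Fin; zero; suc)
open import Data.Fin.Properties using (_≟_)
open import Data.Fin.Subset
  using (Subset; inside; outside; _∈_; _∉_; _⊆_; _∪_; _∩_; _─_; ⁅_⁆; ∣_∣; Nonempty; Empty)
  renaming (⊥ to ∅)
open import Data.Fin.Subset.Properties
  using (nonempty?; _∈?_; ⊆-antisym; ⊆-refl; ⊆-reflexive; ⊥⊆; Empty-unique; x∈⁅x⁆;
         x∈⁅y⁆⇒x≡y; x∈p∪q⁻; x∈p∩q⁺; p⊆p∪q; q⊆p∪q; p∩q⊆p; p∩q⊆q;
         p─q⊆p; p─⊥≡p; p─q─r≡p─r─q; x∈p∧x∉q⇒x∈p─q; x∈p⇒∣p-x∣<∣p∣; ∪-assoc; ∪-comm;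
         ∪-identityʳ; ∣⁅x⁆∣≡1; ∣⊥∣≡0; p⊆q⇒∣p∣≤∣q∣)
open import Data.Integer as ℤ using (ℤ; 0ℤ)
import Data.Integer.Properties as ℤ
open import Data.Integer.Tactic.RingSolver using (solve-∀)
open import Data.List using (List; []; _∷_; map)
import Data.List.Membership.Propositional as List
open import Data.List.Properties using (∷-injectiveˡ)
open import Data.List.Relation.Binary.Permutation.Propositional using (_↭_; ↭-sym; ↭-refl)
import Data.List.Relation.Binary.Permutation.Propositional as ↭
open import Data.List.Relation.Binary.Permutation.Propositional.Properties using (∈-resp-↭)
import Data.List.Relation.Binary.Permutation.Setoid.Properties as ↭ₛ
open import Data.List.Relation.Unary.All using ([]; _∷_)
open import Data.List.Relation.Unary.AllPairs using ([]; _∷_)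
open import Data.List.Relation.Unary.Any using (here; there)
open import Data.Nat using (ℕ; _≤_; _<_)
import Data.Nat.Properties as ℕ
open import Data.Product using (∃!; ∃-syntax; _×_; _,_; proj₁; proj₂)
open import Data.Sum using ([_,_]′)
open import Data.Vec using (_∷_; here; there)
open import Function using (_∘_; id; _⇔_; mk⇔; Equivalence)
open import Relation.Binary.PropositionalEquality
  using (_≡_; _≢_; refl; sym; trans; cong; cong₂; subst; setoid)
open import Relation.Nullary using (¬_; yes; no)
open import Relation.Nullary.Decidable using (decidable-stable)

private
  variable
    k n : ℕ

-- Finite subsets and their differences.

x∈p─q⇒x∉q : ∀ (p q : Subset n) {x} → x ∈ p ─ q → x ∉ q
x∈p─q⇒x∉q (_ ∷ p) (outside ∷ q) {suc x} (there x∈) (there x∈q) = x∈p─q⇒x∉q p q x∈ x∈q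
x∈p─q⇒x∉q (_ ∷ p) (inside ∷ q) {suc x} (there x∈) (there x∈q) = x∈p─q⇒x∉q p q x∈ x∈q
x∈p─q⇒x∉q (outside ∷ p) (inside ∷ q) {zero} () here
x∈p─q⇒x∉q (inside ∷ p) (inside ∷ q) {zero} () here

─-monoˡ : ∀ {p q : Subset n} r → p ⊆ q → p ─ r ⊆ q ─ r
─-monoˡ {p = p} r p⊆q x∈ = x∈p∧x∉q⇒x∈p─q (p⊆q (p─q⊆p p r x∈)) (x∈p─q⇒x∉q p r x∈)

∪-lub : ∀ {p q r : Subset n} → p ⊆ r → q ⊆ r → p ∪ q ⊆ r
∪-lub {p = p} {q} p⊆r q⊆r = [ p⊆r , q⊆r ]′ ∘ x∈p∪q⁻ p q

p⊆q∪p─q : ∀ (p q : Subset n) → p ⊆ q ∪ (p ─ q)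
p⊆q∪p─q p q {x} x∈p with x ∈? q
... | yes x∈q = p⊆p∪q _ x∈q
... | no  x∉q = q⊆p∪q q _ (x∈p∧x∉q⇒x∈p─q x∈p x∉q)

p⊆p─q∪q : ∀ (p q : Subset n) → p ⊆ (p ─ q) ∪ q
p⊆p─q∪q p q x∈p = [ q⊆p∪q _ q , p⊆p∪q q ]′ (x∈p∪q⁻ q _ (p⊆q∪p─q p q x∈p))

x∈p⇒⁅x⁆⊆p : ∀ {x} {p : Subset n} → x ∈ p → ⁅ x ⁆ ⊆ p
x∈p⇒⁅x⁆⊆p {x = x} {p} x∈p y∈ = subst (_∈ p) (sym (x∈⁅y⁆⇒x≡y x y∈)) x∈p

x≢y∧x∈p⇒x∈p─⁅y⁆ : ∀ {x y} {p : Subset n} → x ≢ y → x ∈ p → x ∈ p ─ ⁅ y ⁆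
x≢y∧x∈p⇒x∈p─⁅y⁆ {y = y} x≢y x∈p = x∈p∧x∉q⇒x∈p─q x∈p (x≢y ∘ x∈⁅y⁆⇒x≡y y)

∣p∣≡1⇒p≡⁅x⁆ : ∀ {p : Subset n} → ∣ p ∣ ≡ 1 → ∃[ x ] p ≡ ⁅ x ⁆
∣p∣≡1⇒p≡⁅x⁆ {n} {p} ∣p∣≡1 with nonempty? p
... | no ¬∃ = ⊥-elim (ℕ.0≢1+n (trans (sym (∣⊥∣≡0 n)) (trans (cong ∣_∣ (sym (Empty-unique ¬∃))) ∣p∣≡1)))
... | yes (x , x∈p) = x , ⊆-antisym p⊆⁅x⁆ (x∈p⇒⁅x⁆⊆p x∈p)
  where
  ∣p-x∣<1 : ∣ p ─ ⁅ x ⁆ ∣ < 1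
  ∣p-x∣<1 = subst (∣ p ─ ⁅ x ⁆ ∣ <_) ∣p∣≡1 (x∈p⇒∣p-x∣<∣p∣ x∈p)

  p⊆⁅x⁆ : p ⊆ ⁅ x ⁆
  p⊆⁅x⁆ {y} y∈p with y ≟ x
  ... | yes refl = x∈⁅x⁆ x
  ... | no  y≢x  = ⊥-elim (ℕ.<⇒≱ ∣p-x∣<1
    (subst (_≤ ∣ p ─ ⁅ x ⁆ ∣) (∣⁅x⁆∣≡1 y) (p⊆q⇒∣p∣≤∣q∣ (x∈p⇒⁅x⁆⊆p (x≢y∧x∈p⇒x∈p─⁅y⁆ y≢x y∈p)))))

-- Rank inequalities.

-- Serves to prove rank inequalities by adding up known ones and leaving the cancellation of common
-- terms to the ring solver.
≤-by-difference : ∀ {a b c d : ℤ} → a ℤ.≤ b → b ℤ.- a ≡ d ℤ.- c → c ℤ.≤ d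
≤-by-difference a≤b eq = ℤ.0≤i-j⇒j≤i (subst (0ℤ ℤ.≤_) eq (ℤ.i≤j⇒0≤j-i a≤b))

module _ (M : Polymatroid k n) where
  private
    E = ground M
    r = rank M

  -- Monotonicity is folded into submodularity, so that only inclusions, not equalities of sets,
  -- have to be checked where it is applied.
  submodular-⊆ : ∀ {X Y P Q} → X ⊆ E → Y ⊆ E → P ⊆ X ∪ Y → Q ⊆ X → Q ⊆ Y →
                 r P ℤ.+ r Q ℤ.≤ r X ℤ.+ r Y
  submodular-⊆ {X} {Y} {P} {Q} X⊆E Y⊆E P⊆ Q⊆X Q⊆Y = ℤ.≤-trans
    (ℤ.+-mono-≤ (monotone M P (X ∪ Y) P⊆ (∪-lub X⊆E Y⊆E))
                (monotone M Q (X ∩ Y) (λ x∈ → x∈p∩q⁺ (Q⊆X x∈ , Q⊆Y x∈)) (X⊆E ∘ p∩q⊆p X Y)))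
    (submodular M X Y X⊆E Y⊆E)

  subadditive-⊆ : ∀ {X Y P} → X ⊆ E → Y ⊆ E → P ⊆ X ∪ Y → r P ℤ.≤ r X ℤ.+ r Y
  subadditive-⊆ {X} {Y} {P} X⊆E Y⊆E P⊆ =
    subst (ℤ._≤ r X ℤ.+ r Y) (trans (cong (ℤ._+_ (r P)) (rank-∅ M)) (ℤ.+-identityʳ (r P)))
      (submodular-⊆ X⊆E Y⊆E P⊆ ⊥⊆ ⊥⊆)

-- Separations and their behaviour under removal.

-- X and Y are not required to be disjoint; this makes separations easy to modify.
record Separates (M : Polymatroid k n) (X Y : Subset n) : Set where
  field
    left⊆  : X ⊆ ground M
    right⊆ : Y ⊆ ground M
    covers : ground M ⊆ X ∪ Y
    rank≤  : rank M X ℤ.+ rank M Y ℤ.≤ rank M (ground M)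

open Separates

-- Covering gives `ground M ─ X ⊆ Y`, so shrinking `Y` to the complement of `X` keeps the
-- inequality; subadditivity supplies the reverse one.
connected⇒¬separates : ∀ {M : Polymatroid k n} {X Y} → Connected M → Separates M X Y →
                       Nonempty X → X ≢ ground M → ⊥
connected⇒¬separates {M = M} {X} {Y} con sep X≠∅ X≢E =
  con (X , left⊆ sep , X≠∅ , X≢E , ℤ.≤-antisym
    (ℤ.≤-trans (ℤ.+-monoʳ-≤ (rank M X) (monotone M _ _ E─X⊆Y (right⊆ sep))) (rank≤ sep))
    (subadditive-⊆ M (left⊆ sep) (p─q⊆p _ X) (p⊆q∪p─q _ X)))
  where
  E─X⊆Y : ground M ─ X ⊆ Y
  E─X⊆Y x∈ = [ ⊥-elim ∘ x∈p─q⇒x∉q _ X x∈ , id ]′ (x∈p∪q⁻ X Y (covers sep (p─q⊆p _ X x∈)))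

-- `remove` computes only once the operation is known, so for a variable `α` this has to be a
-- propositional equation.
ground-remove : ∀ α (M : Polymatroid k n) T (T⊆E : T ⊆ ground M) →
                ground (remove α M T T⊆E) ≡ ground M ─ T
ground-remove deletion    M T T⊆E = refl
ground-remove contraction M T T⊆E = refl

separates-remove : ∀ α {M : Polymatroid k n} {X Y T} (T⊆E : T ⊆ ground M) → Separates M X Y →
                   Separates (remove α M T T⊆E) (X ─ T) (Y ─ T)
separates-remove {n = n} α {M} {X} {Y} {T} T⊆E sep = record
  { left⊆  = subst (X ─ T ⊆_) (sym (ground-remove α M T T⊆E)) X′⊆
  ; right⊆ = subst (Y ─ T ⊆_) (sym (ground-remove α M T T⊆E)) Y′⊆
  ; covers = subst (_⊆ (X ─ T) ∪ (Y ─ T)) (sym (ground-remove α M T T⊆E)) covers′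
  ; rank≤  = rank≤′ α
  }
  where
  E = ground M
  E′ = E ─ T
  r = rank M

  X′⊆ : X ─ T ⊆ E′
  X′⊆ = ─-monoˡ T (left⊆ sep)
  Y′⊆ : Y ─ T ⊆ E′
  Y′⊆ = ─-monoˡ T (right⊆ sep)
  E′⊆E : E′ ⊆ E
  E′⊆E = p─q⊆p E T

  covers′ : E′ ⊆ (X ─ T) ∪ (Y ─ T)
  covers′ x∈ = [ p⊆p∪q _ ∘ in-diff , q⊆p∪q _ _ ∘ in-diff ]′ (x∈p∪q⁻ X Y (covers sep (E′⊆E x∈)))
    where
    in-diff : ∀ {Z} → _ ∈ Z → _ ∈ Z ─ T
    in-diff x∈Z = x∈p∧x∉q⇒x∈p─q x∈Z (x∈p─q⇒x∉q E T x∈)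

  -- For the deletion, uncross X with E′ and then Y with X ∪ E′.
  del : ∀ x′ y′ x y e e′ u →
        (x ℤ.+ e′ ℤ.+ (y ℤ.+ u) ℤ.+ e) ℤ.- (u ℤ.+ x′ ℤ.+ (e ℤ.+ y′) ℤ.+ (x ℤ.+ y)) ≡
        e′ ℤ.- (x′ ℤ.+ y′)
  del = solve-∀

  -- For the contraction, uncross `X` with `T` and `Y` with `T`; the ranks of `X ∩ T` and `Y ∩ T`
  -- left over on the smaller side add up to at least that of `T`, since the two sets cover `T`.
  con : ∀ x y e e″ t xt yt p q →
        (x ℤ.+ t ℤ.+ (y ℤ.+ t) ℤ.+ (xt ℤ.+ yt) ℤ.+ e ℤ.+ e″) ℤ.-
        (p ℤ.+ xt ℤ.+ (q ℤ.+ yt) ℤ.+ t ℤ.+ (x ℤ.+ y) ℤ.+ e) ≡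
        (e″ ℤ.- t) ℤ.- ((p ℤ.- t) ℤ.+ (q ℤ.- t))
  con = solve-∀

  rank≤′ : ∀ β → let M′ = remove β M T T⊆E in
           rank M′ (X ─ T) ℤ.+ rank M′ (Y ─ T) ℤ.≤ rank M′ (ground M′)
  rank≤′ deletion = ≤-by-difference
    (ℤ.+-mono-≤ (ℤ.+-mono-≤
      (submodular-⊆ M (left⊆ sep) E′⊆E ⊆-refl (p─q⊆p X T) X′⊆)
      (submodular-⊆ M {P = E} (right⊆ sep) (∪-lub (left⊆ sep) E′⊆E)
        E⊆Y∪U (p─q⊆p Y T) (q⊆p∪q X E′ ∘ Y′⊆)))
      (rank≤ sep))
    (del (r (X ─ T)) (r (Y ─ T)) (r X) (r Y) (r E) (r E′) (r (X ∪ E′)))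
    where
    E⊆Y∪U : E ⊆ Y ∪ (X ∪ E′)
    E⊆Y∪U = [ q⊆p∪q Y _ ∘ p⊆p∪q E′ , p⊆p∪q _ ]′ ∘ x∈p∪q⁻ X Y ∘ covers sep
  rank≤′ contraction = ≤-by-difference
    (ℤ.+-mono-≤ (ℤ.+-mono-≤ (ℤ.+-mono-≤ (ℤ.+-mono-≤
      (submodular-⊆ M (left⊆ sep) T⊆E Z′∪T⊆Z∪T (p∩q⊆p X T) (p∩q⊆q X T))
      (submodular-⊆ M (right⊆ sep) T⊆E Z′∪T⊆Z∪T (p∩q⊆p Y T) (p∩q⊆q Y T)))
      (subadditive-⊆ M (T⊆E ∘ p∩q⊆q X T) (T⊆E ∘ p∩q⊆q Y T) T⊆))
      (rank≤ sep))
      (monotone M E (E′ ∪ T) (p⊆p─q∪q E T) (∪-lub E′⊆E T⊆E)))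
    (con (r X) (r Y) (r E) (r (E′ ∪ T)) (r T) (r (X ∩ T)) (r (Y ∩ T))
         (r ((X ─ T) ∪ T)) (r ((Y ─ T) ∪ T)))
    where
    Z′∪T⊆Z∪T : ∀ {Z} → (Z ─ T) ∪ T ⊆ Z ∪ T
    Z′∪T⊆Z∪T {Z} = ∪-lub (p⊆p∪q T ∘ p─q⊆p Z T) (q⊆p∪q Z T)
    T⊆ : T ⊆ (X ∩ T) ∪ (Y ∩ T)
    T⊆ x∈T = [ (λ x∈X → p⊆p∪q _ (x∈p∩q⁺ (x∈X , x∈T))) , (λ x∈Y → q⊆p∪q _ _ (x∈p∩q⁺ (x∈Y , x∈T))) ]′
               (x∈p∪q⁻ X Y (covers sep (T⊆E x∈T)))

-- For `T ⊆ ground M` the reverse inequality is subadditivity, so `≤` already expresses equality.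
IsSeparator : Polymatroid k n → Subset n → Set
IsSeparator M T = rank M T ℤ.+ rank M (ground M ─ T) ℤ.≤ rank M (ground M)

-- The only separations of M that can disappear when d is removed have {d} as a side.
isSeparator-⁅d⁆ : ∀ δ (M : Polymatroid k n) d (d∈E : d ∈ ground M) → ¬ Connected M →
                  Connected (removeElement δ M d d∈E) → IsSeparator M ⁅ d ⁆
isSeparator-⁅d⁆ δ M d d∈E ¬con con′ =
  -- `¬ Connected M` only doubly negates the existence of a separation, but the goal is decidable
  -- and may be proved by contradiction.
  decidable-stable (_ ℤ.≤? _) λ ¬sep → ¬con λ (X , X⊆E , X≠∅ , X≢E , eq) →
    no-split ¬sep X X⊆E X≠∅ X≢E eq
  where
  E = ground M
  r = rank M

  module _ (¬sep : ¬ IsSeparator M ⁅ d ⁆) where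
    -- A nonempty side inside {d} equals {d}, so the other side contains the complement of {d}, and
    -- monotonicity turns the separation into the excluded one.
    not-lone : ∀ {X Y} → Separates M X Y → Nonempty X → Nonempty (X ─ ⁅ d ⁆)
    not-lone {X} {Y} sep (x , x∈X) = decidable-stable (nonempty? _) λ ¬∃ →
      let only-d : ∀ {y} → y ∈ X → y ≡ d
          only-d {y} y∈X = decidable-stable (y ≟ d) λ y≢d → ¬∃ (y , x≢y∧x∈p⇒x∈p─⁅y⁆ y≢d y∈X)
          E─d⊆Y : E ─ ⁅ d ⁆ ⊆ Y
          E─d⊆Y y∈ = [ (λ y∈X → ⊥-elim (x∈p─q⇒x∉q E ⁅ d ⁆ y∈ (subst (_∈ ⁅ d ⁆) (sym (only-d y∈X)) (x∈⁅x⁆ d))))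
                     , id ]′ (x∈p∪q⁻ X Y (covers sep (p─q⊆p E ⁅ d ⁆ y∈)))
      in ¬sep (ℤ.≤-trans
           (ℤ.+-mono-≤ (monotone M _ _ (x∈p⇒⁅x⁆⊆p (subst (_∈ X) (only-d x∈X) x∈X)) (left⊆ sep))
                       (monotone M _ _ E─d⊆Y (right⊆ sep)))
           (rank≤ sep))

    no-split : ∀ X → X ⊆ E → Nonempty X → X ≢ E → r X ℤ.+ r (E ─ X) ≡ r E → ⊥
    no-split X X⊆E X≠∅ X≢E eq = connected⇒¬separates con′
      (separates-remove δ (x∈p⇒⁅x⁆⊆p d∈E) sep) (not-lone sep X≠∅) λ X′≡E′ →
        -- The complementary side also keeps an element other than `d`, so the trace of `X` is a
        -- proper subset of the new ground set.
        let y , y∈ = not-lone sep-sym Y≠∅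
            y∈Y = p─q⊆p (E ─ X) ⁅ d ⁆ y∈
            y∈E′ = ─-monoˡ ⁅ d ⁆ (p─q⊆p E X) y∈
        in x∈p─q⇒x∉q E X y∈Y (p─q⊆p X ⁅ d ⁆
             (subst (y ∈_) (sym (trans X′≡E′ (ground-remove δ M ⁅ d ⁆ _))) y∈E′))
      where
      sep : Separates M X (E ─ X)
      sep = record { left⊆ = X⊆E ; right⊆ = p─q⊆p E X ; covers = p⊆q∪p─q E X ; rank≤ = ℤ.≤-reflexive eq }
      sep-sym : Separates M (E ─ X) X
      sep-sym = record { left⊆ = p─q⊆p E X ; right⊆ = X⊆E ; covers = p⊆p─q∪q E X
                       ; rank≤ = ℤ.≤-reflexive (trans (ℤ.+-comm (r (E ─ X)) (r X)) eq) }
      Y≠∅ : Nonempty (E ─ X)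
      Y≠∅ = decidable-stable (nonempty? _) λ ¬∃ → X≢E (⊆-antisym X⊆E λ {x} x∈E →
        decidable-stable (x ∈? X) λ x∉X → ¬∃ (x , x∈p∧x∉q⇒x∈p─q x∈E x∉X))

-- Equality of polymatroids, and exchanging operations.

-- `_≈_` unfolds to a pair of equations from which M and N cannot be inferred.
infix 4 _≋_

record _≋_ (M N : Polymatroid k n) : Set where
  constructor ≈⇒≋
  field ≋⇒≈ : M ≈ N

open _≋_

≋⇒ground≡ : ∀ {M N : Polymatroid k n} → M ≋ N → ground M ≡ ground N
≋⇒ground≡ = proj₁ ∘ ≋⇒≈

-- A separator satisfies `r (X ∪ T) = r X + r T` for every `X` in its complement: one direction is
-- subadditivity, the other uncrosses `X ∪ T` with `E ─ T` and then uses the separator inequality.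
isSeparator⇒delete≋contract : ∀ (M : Polymatroid k n) {T} (T⊆E : T ⊆ ground M) →
                              IsSeparator M T → delete M T T⊆E ≋ contract M T T⊆E
isSeparator⇒delete≋contract M {T} T⊆E sep = ≈⇒≋ (refl , λ X X⊆ →
  let X∪T⊆E = ∪-lub (p─q⊆p E T ∘ X⊆) T⊆E in
  ℤ.≤-antisym
    (≤-by-difference
      (ℤ.+-mono-≤ (submodular-⊆ M {P = E} X∪T⊆E (p─q⊆p E T) (E⊆ X) (p⊆p∪q T) X⊆) sep)
      (lower (r X) (r T) (r E) (r (E ─ T)) (r (X ∪ T))))
    (≤-by-difference (subadditive-⊆ M (p─q⊆p E T ∘ X⊆) T⊆E ⊆-refl)
      (upper (r X) (r T) (r (X ∪ T)))))
  where
  E = ground M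
  r = rank M

  E⊆ : ∀ X → E ⊆ (X ∪ T) ∪ (E ─ T)
  E⊆ X = [ p⊆p∪q _ ∘ q⊆p∪q X T , q⊆p∪q _ _ ]′ ∘ x∈p∪q⁻ T _ ∘ p⊆q∪p─q E T

  lower : ∀ x t e e′ xt → (xt ℤ.+ e′ ℤ.+ e) ℤ.- (e ℤ.+ x ℤ.+ (t ℤ.+ e′)) ≡ (xt ℤ.- t) ℤ.- x
  lower = solve-∀

  upper : ∀ x t xt → (x ℤ.+ t) ℤ.- xt ≡ x ℤ.- (xt ℤ.- t)
  upper = solve-∀

≋-refl : ∀ {M : Polymatroid k n} → M ≋ M
≋-refl = ≈⇒≋ (refl , λ _ _ → refl)

≋-sym : ∀ {M N : Polymatroid k n} → M ≋ N → N ≋ M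
≋-sym (≈⇒≋ (eq , f)) = ≈⇒≋ (sym eq , λ X X⊆ → sym (f X (subst (X ⊆_) (sym eq) X⊆)))

≋-trans : ∀ {L M N : Polymatroid k n} → L ≋ M → M ≋ N → L ≋ N
≋-trans (≈⇒≋ (eq , f)) (≈⇒≋ (eq′ , g)) =
  ≈⇒≋ (trans eq eq′ , λ X X⊆ → trans (f X X⊆) (g X (subst (X ⊆_) eq X⊆)))

connected-resp-≋ : ∀ {M N : Polymatroid k n} → M ≋ N → Connected M → Connected N
connected-resp-≋ {M = M} {N} (≈⇒≋ (eq , f)) con (X , X⊆ , X≠∅ , X≢ , split) =
  con (X , X⊆′ , X≠∅ , (λ X≡ → X≢ (trans X≡ eq)) ,
       trans (cong₂ ℤ._+_ (f X X⊆′) (trans (f _ (p─q⊆p _ X)) (cong (λ E → rank N (E ─ X)) eq)))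
             (trans split (sym (trans (f _ ⊆-refl) (cong (rank N) eq)))))
  where
  X⊆′ : X ⊆ ground M
  X⊆′ = subst (X ⊆_) (sym eq) X⊆

remove-cong : ∀ α {M N : Polymatroid k n} {T} (T⊆ : T ⊆ ground M) (T⊆′ : T ⊆ ground N) → M ≋ N →
              remove α M T T⊆ ≋ remove α N T T⊆′
remove-cong deletion    {M} {T = T} T⊆ T⊆′ (≈⇒≋ (eq , f)) =
  ≈⇒≋ (cong (_─ T) eq , λ X X⊆ → f X (p─q⊆p (ground M) T ∘ X⊆))
remove-cong contraction {M} {T = T} T⊆ T⊆′ (≈⇒≋ (eq , f)) =
  ≈⇒≋ (cong (_─ T) eq , λ X X⊆ →
    cong₂ ℤ._-_ (f (X ∪ T) (∪-lub (p─q⊆p (ground M) T ∘ X⊆) T⊆)) (f T T⊆))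

remove-Empty : ∀ α (M : Polymatroid k n) {T} (T⊆E : T ⊆ ground M) → Empty T → remove α M T T⊆E ≋ M
remove-Empty α M T⊆E T-empty with refl ← Empty-unique T-empty = go α
  where
  go : ∀ α → remove α M ∅ T⊆E ≋ M
  go deletion    = ≈⇒≋ (p─⊥≡p (ground M) , λ _ _ → refl)
  go contraction = ≈⇒≋ (p─⊥≡p (ground M) , λ X _ →
    trans (cong₂ ℤ._-_ (cong (rank M) (∪-identityʳ X)) (rank-∅ M)) (ℤ.+-identityʳ _))

remove-≡ : ∀ α {M : Polymatroid k n} {S T} (S⊆ : S ⊆ ground M) (T⊆ : T ⊆ ground M) → S ≡ T →
           remove α M S S⊆ ≋ remove α M T T⊆
remove-≡ α S⊆ T⊆ refl = remove-cong α S⊆ T⊆ ≋-refl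

remove-comm : ∀ α β (M : Polymatroid k n) {S T} (S⊆ : S ⊆ ground M)
              (T⊆ : T ⊆ ground (remove α M S S⊆)) (T⊆′ : T ⊆ ground M)
              (S⊆′ : S ⊆ ground (remove β M T T⊆′)) →
              remove β (remove α M S S⊆) T T⊆ ≋ remove α (remove β M T T⊆′) S S⊆′
remove-comm deletion    deletion    M {S} {T} _ _ _ _ = ≈⇒≋ (p─q─r≡p─r─q _ S T , λ _ _ → refl)
remove-comm deletion    contraction M {S} {T} _ _ _ _ = ≈⇒≋ (p─q─r≡p─r─q _ S T , λ _ _ → refl)
remove-comm contraction deletion    M {S} {T} _ _ _ _ = ≈⇒≋ (p─q─r≡p─r─q _ S T , λ _ _ → refl)
remove-comm contraction contraction M {S} {T} _ _ _ _ = ≈⇒≋ (p─q─r≡p─r─q _ S T , λ X _ →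
  trans (difference (r ((X ∪ T) ∪ S)) (r (T ∪ S)) (r S))
    (trans (cong₂ (λ A B → r A ℤ.- r B) (∪-swap X) (∪-comm T S))
      (sym (difference (r ((X ∪ S) ∪ T)) (r (S ∪ T)) (r T)))))
  where
  r = rank M

  ∪-swap : ∀ X → (X ∪ T) ∪ S ≡ (X ∪ S) ∪ T
  ∪-swap X = trans (∪-assoc X T S) (trans (cong (X ∪_) (∪-comm T S)) (sym (∪-assoc X S T)))

  difference : ∀ x y z → (x ℤ.- z) ℤ.- (y ℤ.- z) ≡ x ℤ.- y
  difference = solve-∀

opposite : Operation → Operation
opposite deletion    = contraction
opposite contraction = deletion

opposite-≢ : ∀ α → opposite α ≢ α
opposite-≢ deletion    ()
opposite-≢ contraction ()

remove-opposite : ∀ α (M : Polymatroid k n) {T} (T⊆E : T ⊆ ground M) → IsSeparator M T →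
                  remove (opposite α) M T T⊆E ≋ remove α M T T⊆E
remove-opposite deletion    M T⊆E sep = ≋-sym (isSeparator⇒delete≋contract M T⊆E sep)
remove-opposite contraction M T⊆E sep = isSeparator⇒delete≋contract M T⊆E sep

-- A rerouted chain meets the old one only up to `≋`; this carries the remaining steps over.
chain-resp-≋ : ∀ {M M′ N : Polymatroid k n} {σ} → M ≋ M′ →
               ConnectedChain N M σ → ConnectedChain N M′ σ
chain-resp-≋ {M = M} {N = N} e ([] e′) = [] (≋⇒≈ (≋-trans (≋-sym e) (≈⇒≋ {M = M} {N} e′)))
chain-resp-≋ e (cons {α = α} {a = a} a∈E con rest) =
  cons a∈E′ (connected-resp-≋ e′ con) (chain-resp-≋ e′ rest)
  where
  a∈E′ = subst (a ∈_) (≋⇒ground≡ e) a∈E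
  e′ = remove-cong α (x∈p⇒⁅x⁆⊆p a∈E) (x∈p⇒⁅x⁆⊆p a∈E′) e

-- Adding the two separator inequalities, and comparing `E ─ B` with `(E ─ A ─ B) ∪ A` by
-- monotonicity, shows that `B ∪ A` and `E ─ B ─ A` separate `M`. Connectedness then forces `B ∪ A`
-- to be all of `E`.
isSeparator-delete-contract : ∀ (M : Polymatroid k n) {A B}
  (A⊆E : A ⊆ ground M) (B⊆E : B ⊆ ground M) → Connected M →
  IsSeparator (delete M B B⊆E) A → IsSeparator (contract M A A⊆E) B →
  Nonempty A → Empty (ground M ─ B ─ A)
isSeparator-delete-contract M {A} {B} A⊆E B⊆E con sepA sepB (x , x∈A) (y , y∈) =
  connected⇒¬separates con sep (x , q⊆p∪q B A x∈A) λ B∪A≡E →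
    [ x∈p─q⇒x∉q E B (p─q⊆p (E ─ B) A y∈) , x∈p─q⇒x∉q (E ─ B) A y∈ ]′
      (x∈p∪q⁻ B A (subst (y ∈_) (sym B∪A≡E) (E─B─A⊆E y∈)))
  where
  E = ground M
  r = rank M

  E─B─A⊆E : E ─ B ─ A ⊆ E
  E─B─A⊆E = p─q⊆p E B ∘ p─q⊆p (E ─ B) A

  E─B⊆ : E ─ B ⊆ (E ─ A ─ B) ∪ A
  E─B⊆ = subst (λ Z → E ─ B ⊆ Z ∪ A) (p─q─r≡p─r─q E B A) (p⊆p─q∪q (E ─ B) A)

  covers′ : E ⊆ (B ∪ A) ∪ (E ─ B ─ A)
  covers′ = subst (E ⊆_) (sym (∪-assoc B A _))
    ([ p⊆p∪q _ , q⊆p∪q B _ ∘ p⊆q∪p─q (E ─ B) A ]′ ∘ x∈p∪q⁻ B _ ∘ p⊆q∪p─q E B)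

  combine : ∀ a ba p q q′ u e →
    (q ℤ.+ (u ℤ.- a) ℤ.+ q′ ℤ.+ e) ℤ.-
    (a ℤ.+ p ℤ.+ ((ba ℤ.- a) ℤ.+ (q′ ℤ.- a)) ℤ.+ q ℤ.+ u) ≡ e ℤ.- (ba ℤ.+ p)
  combine = solve-∀

  sep : Separates M (B ∪ A) (E ─ B ─ A)
  sep = record
    { left⊆  = ∪-lub B⊆E A⊆E
    ; right⊆ = E─B─A⊆E
    ; covers = covers′
    ; rank≤  = ≤-by-difference
        (ℤ.+-mono-≤ (ℤ.+-mono-≤ (ℤ.+-mono-≤ sepA sepB)
          (monotone M _ _ E─B⊆ (∪-lub (p─q⊆p E A ∘ p─q⊆p (E ─ A) B) A⊆E)))
          (monotone M _ _ (∪-lub (p─q⊆p E A) A⊆E) ⊆-refl))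
        (combine (r A) (r (B ∪ A)) (r (E ─ B ─ A)) (r (E ─ B)) (r ((E ─ A ─ B) ∪ A))
                 (r ((E ─ A) ∪ A)) (r E))
    }

-- Rerouting a chain that has at least two steps.

module TwoSteps
  {M N : Polymatroid k n} (conM : Connected M) {α β a b τ} (a≢b : a ≢ b) (a∈E : a ∈ ground M)
  (con₁ : Connected (removeElement α M a a∈E)) (b∈E₁ : b ∈ ground (removeElement α M a a∈E))
  (con₂ : Connected (removeElement β (removeElement α M a a∈E) b b∈E₁))
  (rest : ConnectedChain N (removeElement β (removeElement α M a a∈E) b b∈E₁) τ)
  where

  private
    P = removeElement β (removeElement α M a a∈E) b b∈E₁

    b∈E : b ∈ ground M
    b∈E = p─q⊆p _ ⁅ a ⁆ (subst (b ∈_) (ground-remove α M ⁅ a ⁆ _) b∈E₁)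

    a∈ : ∀ γ → a ∈ ground (removeElement γ M b b∈E)
    a∈ γ = subst (a ∈_) (sym (ground-remove γ M ⁅ b ⁆ _)) (x≢y∧x∈p⇒x∈p─⁅y⁆ a≢b a∈E)

    b∈ : ∀ γ → b ∈ ground (removeElement γ M a a∈E)
    b∈ γ = subst (b ∈_) (sym (ground-remove γ M ⁅ a ⁆ _)) (x≢y∧x∈p⇒x∈p─⁅y⁆ (a≢b ∘ sym) b∈E)

    -- Arguments follow the order of removal: in `bThen γ δ` the operation `γ` acts on `b` and `δ`
    -- on `a`.
    aThen bThen : Operation → Operation → Polymatroid _ _
    aThen γ δ = removeElement δ (removeElement γ M a a∈E) b (b∈ γ)
    bThen γ δ = removeElement δ (removeElement γ M b b∈E) a (a∈ γ)

    swap : ∀ γ δ → aThen γ δ ≋ bThen δ γ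
    swap γ δ = remove-comm γ δ M _ _ _ _

    -- The two sides carry different proofs that `b` lies in the intermediate ground set.
    aThen-αβ : aThen α β ≋ P
    aThen-αβ = remove-cong β _ _ ≋-refl

    ground-P : ground P ≡ ground M ─ ⁅ a ⁆ ─ ⁅ b ⁆
    ground-P = trans (ground-remove β _ ⁅ b ⁆ _) (cong (_─ ⁅ b ⁆) (ground-remove α M ⁅ a ⁆ _))

    extend : ∀ γ δ {c d c∈ d∈} → Connected (removeElement γ M c c∈) →
             removeElement δ (removeElement γ M c c∈) d d∈ ≋ P →
             ConnectedChain N M ((γ , c) ∷ (δ , d) ∷ τ)
    extend _ _ {c∈ = c∈} {d∈} con e = cons c∈ con
      (cons d∈ (connected-resp-≋ (≋-sym e) con₂) (chain-resp-≋ (≋-sym e) rest))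

  -- The competitors are chains removing the same elements in some order; `ordering-by-permutation`
  -- later makes them admissible orderings.
  ¬unique : (∀ {τ′} → ConnectedChain N M τ′ → map proj₂ τ′ ↭ a ∷ b ∷ map proj₂ τ →
             (α , a) ∷ (β , b) ∷ τ ≡ τ′) → ⊥
  ¬unique unique with nonempty? (ground P)
  -- The separation of `M` by {a , b} would be trivial here. Instead {b} is the whole ground set of
  -- `M₁`, hence a separator with empty complement, and `β` can be flipped.
  ... | no P-empty = opposite-≢ β (β̄≡β (unique (extend α (opposite β) con₁ e) ↭-refl))
    where
    M₁ = removeElement α M a a∈E

    b-separates : IsSeparator M₁ ⁅ b ⁆
    b-separates = ℤ.≤-trans
      (ℤ.≤-reflexive (trans (cong (ℤ._+_ (rank M₁ ⁅ b ⁆)) (trans (cong (rank M₁) empty) (rank-∅ M₁)))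
                            (ℤ.+-identityʳ _)))
      (monotone M₁ _ _ (x∈p⇒⁅x⁆⊆p b∈E₁) ⊆-refl)
      where
      empty : ground M₁ ─ ⁅ b ⁆ ≡ ∅
      empty = Empty-unique (subst Empty (ground-remove β M₁ ⁅ b ⁆ _) P-empty)

    e : removeElement (opposite β) M₁ b b∈E₁ ≋ P
    e = remove-opposite β M₁ _ b-separates

    β̄≡β : (α , a) ∷ (β , b) ∷ τ ≡ (α , a) ∷ (opposite β , b) ∷ τ → opposite β ≡ β
    β̄≡β eq = sym (cong second eq)
      where
      second : List (Operation × Fin _) → Operation
      second (_ ∷ (γ , _) ∷ _) = γ
      -- A default for shorter lists; both lists compared have at least two entries.
      second _ = β
  ... | yes P≠∅ = final α s₂ s₁ s₃
    where
    ᾱ = opposite α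
    β̄ = opposite β

    ¬b-first : ∀ γ δ → bThen γ δ ≋ P → ¬ Connected (removeElement γ M b b∈E)
    ¬b-first γ δ e con = a≢b (cong proj₂ (∷-injectiveˡ (unique (extend γ δ con e) (↭.swap b a ↭-refl))))

    bβ≋ : bThen β α ≋ P
    bβ≋ = ≋-trans (≋-sym (swap α β)) aThen-αβ

    ¬bβ : ¬ Connected (removeElement β M b b∈E)
    ¬bβ = ¬b-first β α bβ≋

    s₁ : IsSeparator (removeElement β M b b∈E) ⁅ a ⁆
    s₁ = isSeparator-⁅d⁆ α _ a (a∈ β) ¬bβ (connected-resp-≋ (≋-sym bβ≋) con₂)

    -- By `s₁` the operation on `a` may be flipped once `b` has been removed by `β`; commuting then
    -- puts `a` first.
    aᾱ≋ : aThen ᾱ β ≋ P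
    aᾱ≋ = ≋-trans (swap ᾱ β) (≋-trans (remove-opposite α _ _ s₁) bβ≋)

    ¬aᾱ : ¬ Connected (removeElement ᾱ M a a∈E)
    ¬aᾱ con = opposite-≢ α (sym (cong proj₁ (∷-injectiveˡ (unique (extend ᾱ β con aᾱ≋) ↭-refl))))

    s₂ : IsSeparator (removeElement ᾱ M a a∈E) ⁅ b ⁆
    s₂ = isSeparator-⁅d⁆ β _ b (b∈ ᾱ) ¬aᾱ (connected-resp-≋ (≋-sym aᾱ≋) con₂)

    -- The same exchange with the roles reversed: `s₂` allows `β` to be flipped after `ᾱ` has
    -- removed `a`.
    bβ̄≋ : bThen β̄ ᾱ ≋ P
    bβ̄≋ = ≋-trans (≋-sym (swap ᾱ β̄)) (≋-trans (remove-opposite β _ _ s₂) aᾱ≋)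

    s₃ : IsSeparator (removeElement β̄ M b b∈E) ⁅ a ⁆
    s₃ = isSeparator-⁅d⁆ ᾱ _ a (a∈ β̄) (¬b-first β̄ ᾱ bβ̄≋) (connected-resp-≋ (≋-sym bβ̄≋) con₂)

    both : ∀ γ → IsSeparator (removeElement γ M b b∈E) ⁅ a ⁆ →
           IsSeparator (removeElement (opposite γ) M b b∈E) ⁅ a ⁆ →
           ∀ δ → IsSeparator (removeElement δ M b b∈E) ⁅ a ⁆
    both deletion    s s′ deletion    = s
    both deletion    s s′ contraction = s′
    both contraction s s′ deletion    = s′
    both contraction s s′ contraction = s

    -- `isSeparator-delete-contract` needs a deletion of one element and a contraction of the other.
    -- The case of `γ` tells which kind `sb` concerns, and `both` supplies {a} as a separator for
    -- the complementary kind, whatever `β` is.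
    final : ∀ γ → IsSeparator (removeElement (opposite γ) M a a∈E) ⁅ b ⁆ →
            IsSeparator (removeElement β M b b∈E) ⁅ a ⁆ →
            IsSeparator (removeElement β̄ M b b∈E) ⁅ a ⁆ → ⊥
    final contraction sb sa sa′ =
      isSeparator-delete-contract M (x∈p⇒⁅x⁆⊆p b∈E) (x∈p⇒⁅x⁆⊆p a∈E) conM sb
        (both β sa sa′ contraction) (b , x∈⁅x⁆ b) (subst Nonempty ground-P P≠∅)
    final deletion sb sa sa′ =
      isSeparator-delete-contract M (x∈p⇒⁅x⁆⊆p a∈E) (x∈p⇒⁅x⁆⊆p b∈E) conM (both β sa sa′ deletion)
        sb (a , x∈⁅x⁆ a) (subst Nonempty (trans ground-P (p─q─r≡p─r─q _ ⁅ a ⁆ ⁅ b ⁆)) P≠∅)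

-- Minors whose ground set loses at most one element.

minor⇒ground⊆ : ∀ {M N : Polymatroid k n} → N IsMinorOf M → ground N ⊆ ground M
minor⇒ground⊆ (done (eq , _)) = ⊆-reflexive (sym eq)
minor⇒ground⊆ {M = M} (step α T T⊆E minor) x∈ =
  p─q⊆p _ T (subst (_ ∈_) (ground-remove α M T T⊆E) (minor⇒ground⊆ minor x∈))

-- Every step must remove the empty set, because the ground set of `N` avoids whatever is removed.
minor∧ground≡⇒≋ : ∀ {M N : Polymatroid k n} → N IsMinorOf M → ground M ≡ ground N → M ≋ N
minor∧ground≡⇒≋ (done e) _ = ≈⇒≋ e
minor∧ground≡⇒≋ {M = M} {N} (step α T T⊆E minor) eq =
  ≋-trans (≋-sym e) (minor∧ground≡⇒≋ minor (trans (≋⇒ground≡ e) eq))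
  where
  T-empty : Empty T
  T-empty (x , x∈T) = x∈p─q⇒x∉q _ T
    (subst (x ∈_) (ground-remove α M T T⊆E) (minor⇒ground⊆ minor (subst (x ∈_) eq (T⊆E x∈T)))) x∈T

  e : remove α M T T⊆E ≋ M
  e = remove-Empty α M T⊆E T-empty

-- Steps removing the empty set are skipped. The first nonempty `T` lies outside `N`, so it equals
-- {a}, and the steps after it change nothing.
minor-by-one : ∀ {M N : Polymatroid k n} {a} (a∈E : a ∈ ground M) → N IsMinorOf M →
               ground M ─ ground N ≡ ⁅ a ⁆ → ∃[ α ] removeElement α M a a∈E ≋ N
minor-by-one {a = a} a∈E (done (eq , _)) diff =
  ⊥-elim (x∈p─q⇒x∉q _ _ a∈diff (subst (a ∈_) eq a∈E))
  where a∈diff = subst (a ∈_) (sym diff) (x∈⁅x⁆ a)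
minor-by-one {M = M} {N} {a} a∈E (step α T T⊆E minor) diff with nonempty? T
... | no T-empty =
  let e = remove-Empty α M T⊆E T-empty
      a∈E′ = subst (a ∈_) (sym (≋⇒ground≡ e)) a∈E
      β , e′ = minor-by-one a∈E′ minor (trans (cong (_─ ground N) (≋⇒ground≡ e)) diff)
  in β , ≋-trans (remove-cong β _ _ (≋-sym e)) e′
... | yes (t , t∈T) =
  α , ≋-trans (remove-≡ α _ _ (sym T≡⁅a⁆)) (minor∧ground≡⇒≋ minor ground≡)
  where
  N⊆E─T : ground N ⊆ ground M ─ T
  N⊆E─T x∈ = subst (_ ∈_) (ground-remove α M T T⊆E) (minor⇒ground⊆ minor x∈)

  T⊆⁅a⁆ : T ⊆ ⁅ a ⁆
  T⊆⁅a⁆ {x} x∈T = subst (x ∈_) diff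
    (x∈p∧x∉q⇒x∈p─q (T⊆E x∈T) λ x∈N → x∈p─q⇒x∉q _ T (N⊆E─T x∈N) x∈T)

  T≡⁅a⁆ : T ≡ ⁅ a ⁆
  T≡⁅a⁆ = ⊆-antisym T⊆⁅a⁆ (x∈p⇒⁅x⁆⊆p (subst (_∈ T) (x∈⁅y⁆⇒x≡y a (T⊆⁅a⁆ t∈T)) t∈T))

  ground≡ : ground (remove α M T T⊆E) ≡ ground N
  ground≡ = trans (ground-remove α M T T⊆E) (⊆-antisym E─T⊆N N⊆E─T)
    where
    E─T⊆N : ground M ─ T ⊆ ground N
    E─T⊆N {x} x∈ = decidable-stable (x ∈? ground N) λ x∉N → x∈p─q⇒x∉q _ T x∈
      (subst (x ∈_) (trans diff (sym T≡⁅a⁆)) (x∈p∧x∉q⇒x∈p─q (p─q⊆p _ T x∈) x∉N))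

-- Equality of the two ranks at `E ─ T` says precisely that `T` and its complement separate `M`.
delete≉contract : ∀ (M : Polymatroid k n) {T} (T⊆E : T ⊆ ground M) → Connected M → Nonempty T →
                  T ≢ ground M → ¬ delete M T T⊆E ≋ contract M T T⊆E
delete≉contract M {T} T⊆E con T≠∅ T≢E (≈⇒≋ (_ , f)) = connected⇒¬separates con sep T≠∅ T≢E
  where
  E = ground M
  r = rank M

  split : ∀ x t → (t ℤ.+ (x ℤ.- t)) ≡ x
  split = solve-∀

  sep : Separates M T (E ─ T)
  sep = record
    { left⊆  = T⊆E
    ; right⊆ = p─q⊆p E T
    ; covers = p⊆q∪p─q E T
    ; rank≤  = ℤ.≤-trans
        (ℤ.≤-reflexive (trans (cong (ℤ._+_ (r T)) (f (E ─ T) ⊆-refl))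
                              (split (r ((E ─ T) ∪ T)) (r T))))
        (monotone M _ _ (∪-lub (p─q⊆p E T) T⊆E) ⊆-refl)
    }

operation-unique : ∀ {M N : Polymatroid k n} {a} (a∈E : a ∈ ground M) → Connected M →
                   2 ≤ ∣ ground M ∣ → ∀ α β → removeElement α M a a∈E ≋ N →
                   removeElement β M a a∈E ≋ N → α ≡ β
operation-unique {M = M} {a = a} a∈E con 2≤∣E∣ = go
  where
  -- A second element makes {a} a proper subset; on the ground set {a} both operations would give
  -- the empty polymatroid.
  impossible : ¬ removeElement deletion M a a∈E ≋ removeElement contraction M a a∈E
  impossible = delete≉contract M _ con (a , x∈⁅x⁆ a) λ ⁅a⁆≡E →
    ℕ.1+n≰n (subst (2 ≤_) (trans (cong ∣_∣ (sym ⁅a⁆≡E)) (∣⁅x⁆∣≡1 a)) 2≤∣E∣)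

  go : ∀ α β → _ → _ → α ≡ β
  go deletion    deletion    _ _  = refl
  go contraction contraction _ _  = refl
  go deletion    contraction e e′ = ⊥-elim (impossible (≋-trans e (≋-sym e′)))
  go contraction deletion    e e′ = ⊥-elim (impossible (≋-trans e′ (≋-sym e)))

-- Uniqueness of constrained admissible orderings.

open IsConstrainedAdmissibleOrdering

ordering-by-permutation : ∀ {M N : Polymatroid k n} {σ τ} → IsConstrainedAdmissibleOrdering M N σ →
  ConnectedChain N M τ → map proj₂ τ ↭ map proj₂ σ → IsConstrainedAdmissibleOrdering M N τ
ordering-by-permutation σ-ord chainτ τ↭σ = record
  { distinct = ↭ₛ.Unique-resp-↭ (setoid _) (↭.↭⇒↭ₛ (↭-sym τ↭σ)) (distinct σ-ord)
  ; elements = λ e → mk⇔ (∈-resp-↭ (↭-sym τ↭σ) ∘ Equivalence.to (elements σ-ord e))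
                         (Equivalence.from (elements σ-ord e) ∘ ∈-resp-↭ τ↭σ)
  ; chain    = chainτ
  }

-- By the length of the ordering: length zero would identify `M` with `N`, length one gives the
-- claim, and anything longer admits a second ordering by `TwoSteps`.
unique⇒one-element : ∀ {M N : Polymatroid k n} → Connected M → ¬ N ≈ M →
  ∃! _≡_ (IsConstrainedAdmissibleOrdering M N) → ∣ ground M ─ ground N ∣ ≡ 1
unique⇒one-element {M = M} {N} con N≉M ([] , ord , _) with [] e ← chain ord =
  ⊥-elim (N≉M (≋⇒≈ (≋-sym (≈⇒≋ {M = M} {N} e))))
unique⇒one-element {M = M} {N} con N≉M ((α , a) ∷ [] , ord , _) =
  trans (cong ∣_∣ diff) (∣⁅x⁆∣≡1 a)
  where
  diff : ground M ─ ground N ≡ ⁅ a ⁆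
  diff = ⊆-antisym
    (λ {x} x∈ → case-here (Equivalence.to (elements ord x) x∈))
    (x∈p⇒⁅x⁆⊆p (Equivalence.from (elements ord a) (here refl)))
    where
    case-here : ∀ {x} → x List.∈ a ∷ [] → x ∈ ⁅ a ⁆
    case-here (here refl) = x∈⁅x⁆ a
unique⇒one-element con N≉M ((α , a) ∷ (β , b) ∷ τ , ord , unique)
  with cons a∈E con₁ (cons b∈E₁ con₂ rest) ← chain ord | (a≢b ∷ _) ∷ _ ← distinct ord =
  ⊥-elim (TwoSteps.¬unique con a≢b a∈E con₁ b∈E₁ con₂ rest
    λ chainτ τ↭σ → unique (ordering-by-permutation ord chainτ τ↭σ))

one-element⇒unique : ∀ {M N : Polymatroid k n} → Connected M → Connected N → N IsMinorOf M →
  2 ≤ ∣ ground M ∣ → ∣ ground M ─ ground N ∣ ≡ 1 →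
  ∃! _≡_ (IsConstrainedAdmissibleOrdering M N)
one-element⇒unique {M = M} {N} conM conN minor 2≤∣E∣ ∣diff∣≡1
  with a , diff ← ∣p∣≡1⇒p≡⁅x⁆ ∣diff∣≡1 = (α , a) ∷ [] , record
  { distinct = [] ∷ []
  ; elements = λ e → mk⇔ (λ e∈ → here (only-a e∈)) λ where (here refl) → a∈diff
  ; chain    = cons a∈E (connected-resp-≋ (≋-sym e) conN) ([] (≋⇒≈ e))
  } , unique
  where
  a∈diff : a ∈ ground M ─ ground N
  a∈diff = subst (a ∈_) (sym diff) (x∈⁅x⁆ a)

  a∈E : a ∈ ground M
  a∈E = p─q⊆p _ (ground N) a∈diff

  α = proj₁ (minor-by-one a∈E minor diff)
  e = proj₂ (minor-by-one a∈E minor diff)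

  only-a : ∀ {x} → x ∈ ground M ─ ground N → x ≡ a
  only-a {x} x∈ = x∈⁅y⁆⇒x≡y a (subst (x ∈_) diff x∈)

  -- A competitor must list `a`, hence is nonempty, and two entries would both be `a`, against
  -- distinctness; only the operation remains to be compared.
  unique : ∀ {τ} → IsConstrainedAdmissibleOrdering M N τ → (α , a) ∷ [] ≡ τ
  unique {[]} ord with () ← Equivalence.to (elements ord a) a∈diff
  unique {(β , b) ∷ []} ord
    with refl ← only-a (Equivalence.from (elements ord b) (here refl))
       | cons b∈E _ ([] e′) ← chain ord =
    cong (λ γ → (γ , a) ∷ [])
      (operation-unique a∈E conM 2≤∣E∣ α β e (≋-trans (remove-cong β _ _ ≋-refl) (≈⇒≋ e′)))
  unique {(β , b) ∷ (γ , c) ∷ τ} ord with (b≢c ∷ _) ∷ _ ← distinct ord =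
    ⊥-elim (b≢c (trans (only-a (Equivalence.from (elements ord b) (here refl)))
                       (sym (only-a (Equivalence.from (elements ord c) (there (here refl)))))))

theorem4p1 : ∀ {n : ℕ} (M N : Polymatroid 2 n) →
    Connected M → Connected N → N IsProperMinorOf M →
    2 ≤ ∣ ground M ∣ →
    ∃! _≡_ (IsConstrainedAdmissibleOrdering M N) ⇔ ∣ ground M ─ ground N ∣ ≡ 1
theorem4p1 M N conM conN (minor , N≉M) 2≤∣E∣ =
  mk⇔ (unique⇒one-element conM N≉M) (one-element⇒unique conM conN minor 2≤∣E∣)
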